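{- Let $W$ be a finite Coxeter group and let $x\neq 0$ be a real number. Then $M_{W,x}$ is a signed probability measure on $W$, i.e. $\sum_{w\in W} M_{W,x}(w)=1$.
   Context: $W$ is a finite Coxeter group of rank $n$ acting on its $n$-dimensional real reflection representation $V$, with (reduced, $W$-stable) root system $\Phi$ and base $\Pi$ of simple roots. For $w\in W$, $Des(w)=\{\alpha\in\Pi : w(\alpha)\text{ is a negative root}\}$. For $J\subseteq\Pi$ let $X_J=\{w\in W: Des(w)\cap J=\emptyset\}$ and $x_J=\sum_{w\in X_J}w\in\mathbb{Q}[W]$. On subsets of $\Pi$ put $J\sim K$ iff $w(J)=K$ for some $w\in W$; $\lambda$ denotes an equivalence class, $\lambda(K)$ the class of $K$, $|\lambda|$ the number of subsets in $\lambda$, and $\|\lambda\|=|J|$ for any $J\in\lambda$. For $K\subseteq J\subseteq\Pi$ let $\mu_K^J=\frac{|\{w\in X_J: w(K)\subseteq\Pi\}|}{|\lambda(K)|}$, and $\mu_K^J=0$ if $K\not\subseteq J$. Let $(\beta_K^J)$ be the inverse of the matrix $(\mu_K^J)$ (rows indexed by $J$, columns by $K$). Define $e_\lambda=\frac{1}{|\lambda|}\sum_{J\in\lambda}\sum_{K\subseteq J}\beta_K^J x_K$. (It is known, by Bergeron–Bergeron–Howlett–Taylor, that the $e_\lambda$ are orthogonal idempotents of the group algebra summing to the identity.) For real $x\ne0$ define $M_{W,x}=\sum_\lambda \frac{e_\lambda}{x^{\|\lambda\|}}$ in the group algebra $\mathbb{R}[W]$, and let $M_{W,x}(w)$ be the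 coefficient of $w$ in $M_{W,x}$. A signed probability measure on $W$ is a real-valued function on $W$ (possibly taking negative values) whose values sum to $1$. -}

module Defs where

open import Level using (Level; _⊔_; 0ℓ) renaming (suc to lsuc)
open import Function.Base using (_∘_; case_of_)
open import Function.Bundles using (Inverse; _⇔_; module Equivalence)
open import Data.Bool.Base using (Bool; true; false; if_then_else_)
import Data.Bool.Properties as Bool
open import Data.Nat.Base as ℕ using (ℕ; zero; suc)
open import Data.Fin.Base using (Fin; zero; suc)
import Data.Fin.Properties as Fin
open import Data.Fin.Subset using (Subset; inside; outside; _∈_; _⊆_; _∩_; ⊥; ∣_∣)
open import Data.Fin.Subset.Properties using (_⊆?_; _∈?_; ⊆-refl; drop-∷-⊆; ∩-zeroˡ)
open import Data.Integer.Base as ℤ using (ℤ)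
import Data.Integer.GCD as ℤ
import Data.Integer.Properties as ℤ
open import Data.List.Base as List using (List; []; _∷_; _++_; map; foldr; filter; length; concat; reverse; deduplicate)
import Data.List.Properties as List
import Data.List.Membership.Propositional as List
import Data.List.Membership.Propositional.Properties as List
open import Data.List.Relation.Unary.Any using (here; there)
open import Data.Product.Base using (∃-syntax; _×_; _,_; proj₁; proj₂)
open import Data.Rational.Base as ℚ using (ℚ; 0ℚ; 1ℚ)
import Data.Rational.Properties as ℚ
open import Data.Sum.Base using (_⊎_; inj₁; inj₂)
open import Data.Vec.Base as Vec using ([]; _∷_)
import Data.Vec.Properties as Vec
open import Data.Vec.Functional using (Vector)
open import Algebra.Bundles using (CommutativeRing; Group; Semiring)
open import Algebra.Apartness.Bundles using (HeytingField; HeytingCommutativeRing)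
import Algebra.Definitions.RawMonoid as RawMonoid
import Algebra.Definitions.RawSemiring as RawSemiring
import Algebra.Properties.Monoid.Sum as MonoidSum
open import Relation.Binary.Core using (Rel)
open import Relation.Binary.Definitions using (DecidableEquality)
open import Relation.Binary.Structures using (IsStrictPartialOrder)
open import Relation.Binary.PropositionalEquality as ≡ using (_≡_; _≢_; refl; cong; cong₂; module ≡-Reasoning)
import Relation.Binary.Reasoning.Setoid as SetoidReasoning
open import Relation.Nullary using (¬_; Dec; yes; no; does)
open import Relation.Nullary.Decidable using (_×-dec_; _→-dec_; map′; dec-true; dec-false)
open import Relation.Unary as U using (Pred; Decidable; _≐_)

private variable
  a p c ℓ₁ ℓ₂ ℓ₃ : Level
  n : ℕ

module ListSum (R : CommutativeRing c ℓ₁) where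
  open CommutativeRing R

  ∑ : {A : Set a} → List A → (A → Carrier) → Carrier
  ∑ xs f = foldr _+_ 0# (map f xs)

  infixr 6 ∑
  syntax ∑ xs (λ x → e) = ∑[ x ∈ xs ] e

open ListSum ℚ.+-*-commutativeRing

card : {A : Set a} {P : Pred A p} → Decidable P → List A → ℕ
card P? xs = length (filter P? xs)

subsets : ∀ n → List (Subset n)
subsets zero    = [] ∷ []
subsets (suc n) = map (inside ∷_) (subsets n) ++ map (outside ∷_) (subsets n)

_≟ˢ_ : DecidableEquality (Subset n)
_≟ˢ_ = Vec.≡-dec Bool._≟_

∈-subsets : (J : Subset n) → J List.∈ subsets n
∈-subsets []            = here refl
∈-subsets (inside  ∷ J) = List.∈-++⁺ˡ (List.∈-map⁺ (inside ∷_) (∈-subsets J))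
∈-subsets (outside ∷ J) = List.∈-++⁺ʳ (map (inside ∷_) (subsets _)) (List.∈-map⁺ (outside ∷_) (∈-subsets J))

card-nonZero : {A : Set a} {P : Pred A p} (P? : Decidable P) {x : A} {xs : List A} →
               x List.∈ xs → P x → ℕ.NonZero (card P? xs)
card-nonZero P? {xs = xs} x∈xs px with filter P? xs | List.∈-filter⁺ P? x∈xs px
... | _ ∷ _ | _ = _

if-true : {A : Set a} {b : Bool} {t f : A} → b ≡ true → (if b then t else f) ≡ t
if-true refl = refl

if-false : {A : Set a} {b : Bool} {t f : A} → b ≡ false → (if b then t else f) ≡ f
if-false refl = refl

/-≢0 : ∀ k d {{_ : ℕ.NonZero k}} {{_ : ℕ.NonZero d}} → ℤ.+ k ℚ./ d ≢ 0ℚ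
/-≢0 k d k/d≡0 = ℕ.≢-nonZero⁻¹ k (ℤ.+-injective (begin
  ℤ.+ k                                                ≡⟨ ≡.sym (ℚ.↥-/ (ℤ.+ k) d) ⟩
  ℚ.numerator (ℤ.+ k ℚ./ d) ℤ.* ℤ.gcd (ℤ.+ k) (ℤ.+ d)  ≡⟨ cong (λ q → ℚ.numerator q ℤ.* ℤ.gcd (ℤ.+ k) (ℤ.+ d)) k/d≡0 ⟩
  ℤ.+ 0                                                ∎))
  where open ≡-Reasoning

Matrix : ℕ → Set
Matrix n = Subset n → Subset n → ℚ

infixr 7 _⊗_

_⊗_ : Matrix n → Matrix n → Matrix n
_⊗_ {n} A B J K = ∑[ L ∈ subsets n ] A J L ℚ.* B L K

identityMatrix : Matrix n
identityMatrix J K = if does (J ≟ˢ K) then 1ℚ else 0ℚ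

infix 4 _≗₂_

_≗₂_ : Rel (Matrix n) 0ℓ
A ≗₂ B = ∀ J K → A J K ≡ B J K

IsInverse : Matrix n → Matrix n → Set
IsInverse A B = (A ⊗ B ≗₂ identityMatrix) × (B ⊗ A ≗₂ identityMatrix)

module _ where
  open import Data.Rational.Base using (_+_; _*_; -_)
  open ≡-Reasoning

  private variable
    E F : Set

  ∑-++ : (xs ys : List E) (f : E → ℚ) → ∑ (xs ++ ys) f ≡ ∑ xs f + ∑ ys f
  ∑-++ []       ys f = ≡.sym (ℚ.+-identityˡ _)
  ∑-++ (x ∷ xs) ys f = ≡.trans (cong (f x +_) (∑-++ xs ys f)) (≡.sym (ℚ.+-assoc (f x) _ _))

  ∑-map : (g : F → E) (xs : List F) (f : E → ℚ) → ∑ (map g xs) f ≡ ∑ xs (f ∘ g)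
  ∑-map g xs f = cong (foldr _+_ 0ℚ) (≡.sym (List.map-∘ xs))

  ∑-cong : (xs : List E) {f g : E → ℚ} → (∀ x → f x ≡ g x) → ∑ xs f ≡ ∑ xs g
  ∑-cong xs eq = cong (foldr _+_ 0ℚ) (List.map-cong eq xs)

  ∑-zero : (xs : List E) {f : E → ℚ} → (∀ x → f x ≡ 0ℚ) → ∑ xs f ≡ 0ℚ
  ∑-zero []       eq = refl
  ∑-zero (x ∷ xs) eq = cong₂ _+_ (eq x) (∑-zero xs eq)

  ∑-+ : (xs : List E) (f g : E → ℚ) → ∑ xs (λ x → f x + g x) ≡ ∑ xs f + ∑ xs g
  ∑-+ []       f g = refl
  ∑-+ (x ∷ xs) f g = begin
    f x + g x + ∑ xs (λ y → f y + g y)  ≡⟨ cong (f x + g x +_) (∑-+ xs f g) ⟩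
    f x + g x + (∑ xs f + ∑ xs g)       ≡⟨ ℚ.+-assoc (f x) _ _ ⟩
    f x + (g x + (∑ xs f + ∑ xs g))     ≡⟨ cong (f x +_) (≡.sym (ℚ.+-assoc (g x) _ _)) ⟩
    f x + (g x + ∑ xs f + ∑ xs g)       ≡⟨ cong (λ t → f x + (t + ∑ xs g)) (ℚ.+-comm (g x) _) ⟩
    f x + (∑ xs f + g x + ∑ xs g)       ≡⟨ cong (f x +_) (ℚ.+-assoc (∑ xs f) _ _) ⟩
    f x + (∑ xs f + (g x + ∑ xs g))     ≡⟨ ≡.sym (ℚ.+-assoc (f x) _ _) ⟩
    f x + ∑ xs f + (g x + ∑ xs g)       ∎

  ∑-*ˡ : (q : ℚ) (xs : List E) (f : E → ℚ) → q * ∑ xs f ≡ ∑ xs (λ x → q * f x)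
  ∑-*ˡ q []       f = ℚ.*-zeroʳ q
  ∑-*ˡ q (x ∷ xs) f = ≡.trans (ℚ.*-distribˡ-+ q _ _) (cong (q * f x +_) (∑-*ˡ q xs f))

  ∑-*ʳ : (q : ℚ) (xs : List E) (f : E → ℚ) → ∑ xs f * q ≡ ∑ xs (λ x → f x * q)
  ∑-*ʳ q xs f = ≡.trans (ℚ.*-comm _ q) (≡.trans (∑-*ˡ q xs f) (∑-cong xs λ x → ℚ.*-comm q (f x)))

  ∑-swap : (xs : List E) (ys : List F) (f : E → F → ℚ) →
           ∑ xs (λ x → ∑ ys (f x)) ≡ ∑ ys (λ y → ∑ xs (λ x → f x y))
  ∑-swap []       ys f = ≡.sym (∑-zero ys λ _ → refl)
  ∑-swap (x ∷ xs) ys f = ≡.trans (cong (∑ ys (f x) +_) (∑-swap xs ys f)) (≡.sym (∑-+ ys _ _))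

  ∑-subsets-suc : (f : Subset (suc n) → ℚ) →
                  ∑ (subsets (suc n)) f ≡ ∑ (subsets n) (f ∘ (inside ∷_)) + ∑ (subsets n) (f ∘ (outside ∷_))
  ∑-subsets-suc {n} f = ≡.trans (∑-++ (map (inside ∷_) (subsets n)) _ f)
    (cong₂ _+_ (∑-map (inside ∷_) (subsets n) f) (∑-map (outside ∷_) (subsets n) f))

  ⊗-assoc : (A B C : Matrix n) → (A ⊗ B) ⊗ C ≗₂ A ⊗ (B ⊗ C)
  ⊗-assoc {n} A B C J K = begin
    ∑ S (λ L → ∑ S (λ L′ → A J L′ * B L′ L) * C L K)    ≡⟨ ∑-cong S (λ L → ∑-*ʳ (C L K) S _) ⟩
    ∑ S (λ L → ∑ S (λ L′ → A J L′ * B L′ L * C L K))    ≡⟨ ∑-swap S S _ ⟩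
    ∑ S (λ L′ → ∑ S (λ L → A J L′ * B L′ L * C L K))    ≡⟨ ∑-cong S (λ L′ → ∑-cong S λ L → ℚ.*-assoc (A J L′) _ _) ⟩
    ∑ S (λ L′ → ∑ S (λ L → A J L′ * (B L′ L * C L K)))  ≡⟨ ∑-cong S (λ L′ → ≡.sym (∑-*ˡ (A J L′) S _)) ⟩
    ∑ S (λ L′ → A J L′ * ∑ S (λ L → B L′ L * C L K))    ∎
    where S = subsets n

  ⊗-cong : {A A′ B B′ : Matrix n} → A ≗₂ A′ → B ≗₂ B′ → A ⊗ B ≗₂ A′ ⊗ B′
  ⊗-cong {n} A≗ B≗ J K = ∑-cong (subsets n) λ L → cong₂ _*_ (A≗ J L) (B≗ L K)

  ⊗-identityˡ : (A : Matrix n) → identityMatrix ⊗ A ≗₂ A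
  ⊗-identityˡ {zero}  A []            []      = ≡.trans (ℚ.+-identityʳ _) (ℚ.*-identityˡ _)
  ⊗-identityˡ {suc n} A (inside ∷ J)  K = begin
    _                  ≡⟨ ∑-subsets-suc (λ L → identityMatrix (inside ∷ J) L * A L K) ⟩
    _                  ≡⟨ cong₂ _+_ (⊗-identityˡ (λ I _ → A (inside ∷ I) K) J J) (∑-zero (subsets n) λ L → ℚ.*-zeroˡ (A (outside ∷ L) K)) ⟩
    A _ K + 0ℚ         ≡⟨ ℚ.+-identityʳ _ ⟩
    A (inside ∷ J) K   ∎
  ⊗-identityˡ {suc n} A (outside ∷ J) K = begin
    _                  ≡⟨ ∑-subsets-suc (λ L → identityMatrix (outside ∷ J) L * A L K) ⟩
    _                  ≡⟨ cong₂ _+_ (∑-zero (subsets n) λ L → ℚ.*-zeroˡ (A (inside ∷ L) K)) (⊗-identityˡ (λ I _ → A (outside ∷ I) K) J J) ⟩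
    0ℚ + A _ K         ≡⟨ ℚ.+-identityˡ _ ⟩
    A (outside ∷ J) K  ∎

  ⊗-identityʳ : (A : Matrix n) → A ⊗ identityMatrix ≗₂ A
  ⊗-identityʳ {zero}  A []      []            = ≡.trans (ℚ.+-identityʳ _) (ℚ.*-identityʳ _)
  ⊗-identityʳ {suc n} A J (inside ∷ K) = begin
    _                  ≡⟨ ∑-subsets-suc (λ L → A J L * identityMatrix L (inside ∷ K)) ⟩
    _                  ≡⟨ cong₂ _+_ (⊗-identityʳ (λ _ I → A J (inside ∷ I)) K K) (∑-zero (subsets n) λ L → ℚ.*-zeroʳ (A J (outside ∷ L))) ⟩
    A J _ + 0ℚ         ≡⟨ ℚ.+-identityʳ _ ⟩
    A J (inside ∷ K)   ∎
  ⊗-identityʳ {suc n} A J (outside ∷ K) = begin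
    _                  ≡⟨ ∑-subsets-suc (λ L → A J L * identityMatrix L (outside ∷ K)) ⟩
    _                  ≡⟨ cong₂ _+_ (∑-zero (subsets n) λ L → ℚ.*-zeroʳ (A J (inside ∷ L))) (⊗-identityʳ (λ _ I → A J (outside ∷ I)) K K) ⟩
    0ℚ + A J _         ≡⟨ ℚ.+-identityˡ _ ⟩
    A J (outside ∷ K)  ∎

  neg-⊗ʳ : (A B : Matrix n) → A ⊗ (λ J K → - B J K) ≗₂ (λ J K → - (A ⊗ B) J K)
  neg-⊗ʳ {n} A B J K = begin
    ∑ S (λ L → A J L * - B L K)          ≡⟨ ∑-cong S (λ L → ≡.sym (ℚ.neg-distribʳ-* (A J L) (B L K))) ⟩
    ∑ S (λ L → - (A J L * B L K))        ≡⟨ ∑-cong S (λ L → ℚ.neg-distribˡ-* (A J L) (B L K)) ⟩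
    ∑ S (λ L → - A J L * B L K)          ≡⟨ ∑-cong S (λ L → cong (_* B L K) (neg (A J L))) ⟩
    ∑ S (λ L → - 1ℚ * A J L * B L K)     ≡⟨ ∑-cong S (λ L → ℚ.*-assoc (- 1ℚ) (A J L) (B L K)) ⟩
    ∑ S (λ L → - 1ℚ * (A J L * B L K))   ≡⟨ ≡.sym (∑-*ˡ (- 1ℚ) S _) ⟩
    - 1ℚ * ∑ S (λ L → A J L * B L K)     ≡⟨ ≡.sym (neg _) ⟩
    - ∑ S (λ L → A J L * B L K)          ∎
    where
    S = subsets n
    neg : ∀ q → - q ≡ - 1ℚ * q
    neg q = ≡.trans (cong -_ (≡.sym (ℚ.*-identityˡ q))) (ℚ.neg-distribˡ-* 1ℚ q)

  neg-⊗ˡ : (A B : Matrix n) → (λ J K → - A J K) ⊗ B ≗₂ (λ J K → - (A ⊗ B) J K)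
  neg-⊗ˡ {n} A B J K = ≡.trans
    (∑-cong (subsets n) λ L → ≡.trans (≡.sym (ℚ.neg-distribˡ-* (A J L) (B L K))) (ℚ.neg-distribʳ-* (A J L) (B L K)))
    (neg-⊗ʳ A B J K)

  -- By blocks: the first element of the index set splits A into
  -- ( A₁ C ; 0 A₂ ), with inverse ( A₁⁻¹ -A₁⁻¹CA₂⁻¹ ; 0 A₂⁻¹ ).
  triangular⇒invertible : (A : Matrix n) →
                          (∀ {J K} → ¬ K ⊆ J → A J K ≡ 0ℚ) →
                          (∀ J → A J J ≢ 0ℚ) →
                          ∃[ B ] IsInverse A B
  triangular⇒invertible {zero} A tri diag =
    (λ _ _ → ℚ.1/ A₀) ,
    (λ { [] [] → ≡.trans (ℚ.+-identityʳ _) (ℚ.*-inverseʳ A₀) }) ,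
    (λ { [] [] → ≡.trans (ℚ.+-identityʳ _) (ℚ.*-inverseˡ A₀) })
    where
    A₀ = A [] []
    instance
      A₀≢0 : ℚ.NonZero A₀
      A₀≢0 = ℚ.≢-nonZero (diag [])
  triangular⇒invertible {suc n} A tri diag = B , AB , BA
    where
    A₁ A₂ C : Matrix n
    A₁ J K = A (inside  ∷ J) (inside  ∷ K)
    A₂ J K = A (outside ∷ J) (outside ∷ K)
    C  J K = A (inside  ∷ J) (outside ∷ K)

    corner : ∀ J K → A (outside ∷ J) (inside ∷ K) ≡ 0ℚ
    corner J K = tri λ K⊆J → case K⊆J Vec.here of λ ()

    IH₁ = triangular⇒invertible A₁ (λ K⊈J → tri (K⊈J ∘ drop-∷-⊆)) (diag ∘ (inside ∷_))
    IH₂ = triangular⇒invertible A₂ (λ K⊈J → tri (K⊈J ∘ drop-∷-⊆)) (diag ∘ (outside ∷_))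
    B₁ = proj₁ IH₁
    B₂ = proj₁ IH₂
    X  = B₁ ⊗ C ⊗ B₂

    B : Matrix (suc n)
    B (inside  ∷ J) (inside  ∷ K) = B₁ J K
    B (inside  ∷ J) (outside ∷ K) = - X J K
    B (outside ∷ J) (inside  ∷ K) = 0ℚ
    B (outside ∷ J) (outside ∷ K) = B₂ J K

    A₁X : A₁ ⊗ X ≗₂ C ⊗ B₂
    A₁X J K = ≡.trans (≡.sym (⊗-assoc A₁ B₁ (C ⊗ B₂) J K))
      (≡.trans (⊗-cong {A′ = identityMatrix} {B = C ⊗ B₂} {B′ = C ⊗ B₂} (proj₁ (proj₂ IH₁)) (λ _ _ → refl) J K) (⊗-identityˡ (C ⊗ B₂) J K))

    XA₂ : X ⊗ A₂ ≗₂ B₁ ⊗ C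
    XA₂ J K = ≡.trans (⊗-assoc B₁ (C ⊗ B₂) A₂ J K) (⊗-cong {A = B₁} {A′ = B₁} {B′ = C} (λ _ _ → refl) CB₂A₂ J K)
      where
      CB₂A₂ : (C ⊗ B₂) ⊗ A₂ ≗₂ C
      CB₂A₂ J K = ≡.trans (⊗-assoc C B₂ A₂ J K)
        (≡.trans (⊗-cong {A = C} {A′ = C} {B′ = identityMatrix} (λ _ _ → refl) (proj₂ (proj₂ IH₂)) J K) (⊗-identityʳ C J K))

    AB : A ⊗ B ≗₂ identityMatrix
    AB J@(inside ∷ J′) K@(inside ∷ K′) = ≡.trans (∑-subsets-suc (λ L → A J L * B L K))
      (≡.trans (cong₂ _+_ (proj₁ (proj₂ IH₁) J′ K′) (∑-zero (subsets n) λ L → ℚ.*-zeroʳ (C J′ L))) (ℚ.+-identityʳ _))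
    AB J@(inside ∷ J′) K@(outside ∷ K′) = ≡.trans (∑-subsets-suc (λ L → A J L * B L K))
      (≡.trans (cong (_+ (C ⊗ B₂) J′ K′) (≡.trans (neg-⊗ʳ A₁ X J′ K′) (cong -_ (A₁X J′ K′)))) (ℚ.+-inverseˡ ((C ⊗ B₂) J′ K′)))
    AB J@(outside ∷ J′) K@(inside ∷ K′) = ≡.trans (∑-subsets-suc (λ L → A J L * B L K))
      (cong₂ _+_ (∑-zero (subsets n) λ L → ≡.trans (cong (_* B₁ L K′) (corner J′ L)) (ℚ.*-zeroˡ (B₁ L K′)))
                 (∑-zero (subsets n) λ L → ℚ.*-zeroʳ (A₂ J′ L)))
    AB J@(outside ∷ J′) K@(outside ∷ K′) = ≡.trans (∑-subsets-suc (λ L → A J L * B L K))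
      (≡.trans (cong₂ _+_ (∑-zero (subsets n) λ L → ≡.trans (cong (_* - X L K′) (corner J′ L)) (ℚ.*-zeroˡ (- X L K′)))
                          (proj₁ (proj₂ IH₂) J′ K′)) (ℚ.+-identityˡ _))

    BA : B ⊗ A ≗₂ identityMatrix
    BA J@(inside ∷ J′) K@(inside ∷ K′) = ≡.trans (∑-subsets-suc (λ L → B J L * A L K))
      (≡.trans (cong₂ _+_ (proj₂ (proj₂ IH₁) J′ K′)
                          (∑-zero (subsets n) λ L → ≡.trans (cong (- X J′ L *_) (corner L K′)) (ℚ.*-zeroʳ (- X J′ L))))
               (ℚ.+-identityʳ _))
    BA J@(inside ∷ J′) K@(outside ∷ K′) = ≡.trans (∑-subsets-suc (λ L → B J L * A L K))
      (≡.trans (cong ((B₁ ⊗ C) J′ K′ +_) (≡.trans (neg-⊗ˡ X A₂ J′ K′) (cong -_ (XA₂ J′ K′)))) (ℚ.+-inverseʳ ((B₁ ⊗ C) J′ K′)))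
    BA J@(outside ∷ J′) K@(inside ∷ K′) = ≡.trans (∑-subsets-suc (λ L → B J L * A L K))
      (cong₂ _+_ (∑-zero (subsets n) λ L → ℚ.*-zeroˡ (A₁ L K′))
                 (∑-zero (subsets n) λ L → ≡.trans (cong (B₂ J′ L *_) (corner L K′)) (ℚ.*-zeroʳ (B₂ J′ L))))
    BA J@(outside ∷ J′) K@(outside ∷ K′) = ≡.trans (∑-subsets-suc (λ L → B J L * A L K))
      (≡.trans (cong₂ _+_ (∑-zero (subsets n) λ L → ℚ.*-zeroˡ (C L K′)) (proj₂ (proj₂ IH₂) J′ K′)) (ℚ.+-identityˡ _))

-- The library has no real numbers, so they are given by their axioms: a
-- Cauchy complete Archimedean ordered field.  Classically any two of these
-- are isomorphic.  The order is not assumed decidable, so that constructive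
-- models qualify too; `#` plays the role of ≠.
record RealNumbers c ℓ₁ ℓ₂ ℓ₃ : Set (lsuc (c ⊔ ℓ₁ ⊔ ℓ₂ ⊔ ℓ₃)) where
  field
    heytingField : HeytingField c ℓ₁ ℓ₂
  open HeytingField heytingField public renaming (refl to ≈-refl; sym to ≈-sym; trans to ≈-trans)

  infix 4 _<_ _≤_
  field
    _<_                  : Rel Carrier ℓ₃
    isStrictPartialOrder : IsStrictPartialOrder _≈_ _<_
    #⇔<⊎>                : ∀ {x y} → x # y ⇔ (x < y ⊎ y < x)
    0<1                  : 0# < 1#
    +-monoˡ-<            : ∀ {x y} z → x < y → x + z < y + z
    *-pos                : ∀ {x y} → 0# < x → 0# < y → 0# < x * y

  open HeytingCommutativeRing heytingCommutativeRing public using (commutativeRing)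
  open CommutativeRing commutativeRing public using (+-rawMonoid; +-monoid; semiring)
  open RawSemiring (Semiring.rawSemiring semiring) public using (_^_)
  open RawMonoid +-rawMonoid public using (sum) renaming (_×_ to _·_)

  _≤_ : Rel Carrier ℓ₃
  x ≤ y = ¬ (y < x)

  fromℕ : ℕ → Carrier
  fromℕ k = k · 1#

  Cauchy : (ℕ → Carrier) → Set (c ⊔ ℓ₃)
  Cauchy u = ∀ ε → 0# < ε → ∃[ N ] ∀ i j → N ℕ.≤ i → N ℕ.≤ j → u i < u j + ε

  _ConvergesTo_ : (ℕ → Carrier) → Carrier → Set (c ⊔ ℓ₃)
  u ConvergesTo l = ∀ ε → 0# < ε → ∃[ N ] ∀ i → N ℕ.≤ i → u i < l + ε × l < u i + ε

  field
    archimedean : ∀ x → ∃[ k ] x < fromℕ k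
    complete    : ∀ u → Cauchy u → ∃[ l ] u ConvergesTo l

  open IsStrictPartialOrder isStrictPartialOrder public
    using (<-respʳ-≈; <-respˡ-≈) renaming (irrefl to <-irrefl; trans to <-trans; asym to <-asym)

  infix 9 _⁻¹

  -- Literally an inverse of x - 0#, which is what a Heyting field provides.
  _⁻¹ : ∀ {x} → x # 0# → Carrier
  x#0 ⁻¹ = proj₁ (#⇒invertible x#0)

  0<fromℕ-suc : ∀ k → 0# < fromℕ (suc k)
  0<fromℕ-suc zero    = <-respʳ-≈ (≈-sym (+-identityʳ 1#)) 0<1
  0<fromℕ-suc (suc k) = <-trans (0<fromℕ-suc k)
    (<-respˡ-≈ (+-identityˡ _) (+-monoˡ-< (fromℕ (suc k)) 0<1))

  fromℕ-suc#0 : ∀ k → fromℕ (suc k) # 0#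
  fromℕ-suc#0 k = Equivalence.from #⇔<⊎> (inj₂ (0<fromℕ-suc k))

  fromℤ : ℤ → Carrier
  fromℤ (ℤ.+ k)    = fromℕ k
  fromℤ ℤ.-[1+ k ] = - fromℕ (suc k)

  fromℚ : ℚ → Carrier
  fromℚ q = fromℤ (ℚ.numerator q) * fromℕ-suc#0 (ℚ.denominator-1 q) ⁻¹

  ≤-antisym : ∀ {x y} → x ≤ y → y ≤ x → x ≈ y
  ≤-antisym {x} {y} x≤y y≤x = proj₁ (tight x y) λ x#y → case Equivalence.to #⇔<⊎> x#y of λ where
    (inj₁ x<y) → y≤x x<y
    (inj₂ y<x) → x≤y y<x

record CoxeterMatrix (n : ℕ) : Set where
  field
    m           : Fin n → Fin n → ℕ          -- 0 stands for ∞
    symmetric   : ∀ i j → m i j ≡ m j i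
    diagonal    : ∀ i → m i i ≡ 1
    offDiagonal : ∀ {i j} → i ≢ j → m i j ≢ 1

Word : ℕ → Set
Word n = List (Fin n)

module _ (M : CoxeterMatrix n) where
  open CoxeterMatrix M

  -- Equality in the group presented by ⟨ s₁ … sₙ ∣ (sᵢsⱼ)^mᵢⱼ = 1 ⟩.  Since
  -- sᵢ² = 1 is among the relations, words in the generators suffice.
  data Equal : Rel (Word n) 0ℓ where
    relation : ∀ i j → Equal (concat (List.replicate (m i j) (i ∷ j ∷ []))) []
    ++-cong  : ∀ {u u′ v v′} → Equal u u′ → Equal v v′ → Equal (u ++ v) (u′ ++ v′)
    refl     : ∀ {u} → Equal u u
    sym      : ∀ {u v} → Equal u v → Equal v u
    trans    : ∀ {u v w} → Equal u v → Equal v w → Equal u w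

  private
    reflexive : ∀ {u v} → u ≡ v → Equal u v
    reflexive ≡.refl = refl

    square : ∀ i → Equal (i ∷ i ∷ []) []
    square i = ≡.subst (λ k → Equal (concat (List.replicate k (i ∷ i ∷ []))) []) (diagonal i) (relation i i)

    inverseˡ : ∀ u → Equal (reverse u ++ u) []
    inverseˡ []      = refl
    inverseˡ (i ∷ u) = trans (reflexive eq)
      (trans (++-cong (refl {reverse u}) (++-cong (square i) (refl {u}))) (inverseˡ u))
      where
      eq : reverse (i ∷ u) ++ i ∷ u ≡ reverse u ++ i ∷ i ∷ u
      eq = ≡.trans (cong (_++ i ∷ u) (List.unfold-reverse i u)) (List.++-assoc (reverse u) (i ∷ []) (i ∷ u))

    inverseʳ : ∀ u → Equal (u ++ reverse u) []
    inverseʳ u = ≡.subst (λ v → Equal (v ++ reverse u) []) (List.reverse-involutive u) (inverseˡ (reverse u))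

    reverse-cong : ∀ {u v} → Equal u v → Equal (reverse u) (reverse v)
    reverse-cong {u} {v} u≈v =
      trans (reflexive (≡.sym (List.++-identityʳ (reverse u))))
      (trans (++-cong (refl {reverse u}) (trans (sym (inverseʳ v)) (++-cong (sym u≈v) (refl {reverse v}))))
      (trans (reflexive (≡.sym (List.++-assoc (reverse u) u (reverse v))))
             (++-cong (inverseˡ u) (refl {reverse v}))))

  coxeterGroup : Group 0ℓ 0ℓ
  coxeterGroup = record
    { Carrier = Word n
    ; _≈_     = Equal
    ; _∙_     = _++_
    ; ε       = []
    ; _⁻¹     = reverse
    ; isGroup = record
      { isMonoid = record
        { isSemigroup = record
          { isMagma = record
            { isEquivalence = record { refl = refl ; sym = sym ; trans = trans }
            ; ∙-cong        = ++-cong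
            }
          ; assoc = λ u v w → reflexive (List.++-assoc u v w)
          }
        ; identity = (λ _ → refl) , (λ u → reflexive (List.++-identityʳ u))
        }
      ; inverse = inverseˡ , inverseʳ
      ; ⁻¹-cong = reverse-cong
      }
    }

record FiniteCoxeterGroup (n : ℕ) : Set where
  field
    matrix      : CoxeterMatrix n
    order       : ℕ
    enumeration : Inverse (≡.setoid (Fin order)) (Group.setoid (coxeterGroup matrix))

  group : Group 0ℓ 0ℓ
  group = coxeterGroup matrix

  open Group group public using (_≈_)

  elements : List (Word n)
  elements = List.tabulate (Inverse.to enumeration)

module Euclidean (ℝ : RealNumbers c ℓ₁ ℓ₂ ℓ₃) (n : ℕ) where
  open RealNumbers ℝ

  V : Set c
  V = Vector Carrier n

  infix 4 _≋_

  _≋_ : Rel V ℓ₁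
  v ≋ w = ∀ i → v i ≈ w i

  ⟨_,_⟩ : V → V → Carrier
  ⟨ v , w ⟩ = sum (λ i → v i * w i)

  -- s_a(v) = v - 2⟨v,a⟩/⟨a,a⟩ a
  reflection : (a : V) → ⟨ a , a ⟩ # 0# → V → V
  reflection a ‖a‖²#0 v i = v i - (1# + 1#) * ⟨ v , a ⟩ * ‖a‖²#0 ⁻¹ * a i

  combination : ∀ {k} → Vector Carrier k → Vector V k → V
  combination c v i = sum (λ j → c j * v j i)

record RootSystem (ℝ : RealNumbers c ℓ₁ ℓ₂ ℓ₃) (n : ℕ) : Set (c ⊔ ℓ₁ ⊔ ℓ₂) where
  open RealNumbers ℝ
  open Euclidean ℝ n
  field
    size      : ℕ
    root      : Fin size → V
    injective : ∀ {r s} → root r ≋ root s → r ≡ s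
    nonzero   : ∀ r → ⟨ root r , root r ⟩ # 0#
    reduced   : ∀ {r s} x → root s ≋ (λ i → x * root r i) → x ≈ 1# ⊎ x ≈ - 1#
    stable    : ∀ r s → ∃[ t ] reflection (root r) (nonzero r) (root s) ≋ root t

record Base {ℝ : RealNumbers c ℓ₁ ℓ₂ ℓ₃} {n} (Φ : RootSystem ℝ n) : Set (c ⊔ ℓ₁ ⊔ ℓ₃) where
  open RealNumbers ℝ
  open Euclidean ℝ n
  open RootSystem Φ
  field
    simple : Fin n → Fin size

  α : Fin n → V
  α i = root (simple i)

  Positive : Pred (Fin size) (c ⊔ ℓ₁ ⊔ ℓ₃)
  Positive r = ∃[ c ] (∀ i → 0# ≤ c i) × root r ≋ combination c α

  Negative : Pred (Fin size) (c ⊔ ℓ₁ ⊔ ℓ₃)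
  Negative r = ∃[ c ] (∀ i → c i ≤ 0#) × root r ≋ combination c α

  field
    spanning    : ∀ v → ∃[ c ] v ≋ combination c α
    independent : ∀ {c d} → combination c α ≋ combination d α → c ≋ d
    sign        : ∀ r → Positive r ⊎ Negative r

-- The reflection representation of W on V = ℝⁿ, with the invariant inner
-- product as the standard one: the generator sᵢ acts as the reflection in
-- the i-th simple root.
record ReflectionRepresentation (ℝ : RealNumbers c ℓ₁ ℓ₂ ℓ₃) {n} (W : FiniteCoxeterGroup n)
       : Set (c ⊔ ℓ₁ ⊔ ℓ₂ ⊔ ℓ₃) where
  open Euclidean ℝ n public
  open FiniteCoxeterGroup W using () renaming (_≈_ to _~_)
  field
    Φ : RootSystem ℝ n
    Π : Base Φ
  open RootSystem Φ public
  open Base Π public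

  act : Word n → V → V
  act w v = foldr (λ i → reflection (α i) (nonzero (simple i))) v w

  -- Left to right: the sᵢ satisfy the defining relations of W, so that `act`
  -- is a representation of W.  Right to left: it is a faithful one.
  field
    faithful : ∀ u w → u ~ w ⇔ (∀ v → act u v ≋ act w v)

module _ {ℝ : RealNumbers c ℓ₁ ℓ₂ ℓ₃} {n} {W : FiniteCoxeterGroup n} (R : ReflectionRepresentation ℝ W) where
  open RealNumbers ℝ renaming (_⁻¹ to _⁻¹ᴿ)
  open FiniteCoxeterGroup W using (enumeration; elements) renaming (_≈_ to _~_)
  open ReflectionRepresentation R
  open MonoidSum +-monoid using (sum-cong-≋; sum-replicate-zero)

  infixr 7 _•_

  -- The action of W on the indices of the roots.
  _•_ : Word n → Fin size → Fin size
  w • r = foldr (λ i s → proj₁ (stable (simple i) s)) r w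

  reflection-cong : ∀ a a#0 {v w} → v ≋ w → reflection a a#0 v ≋ reflection a a#0 w
  reflection-cong a a#0 v≋w i = +-cong (v≋w i) (-‿cong (*-congʳ (*-congʳ (*-congˡ
    (sum-cong-≋ λ j → *-congʳ (v≋w j))))))

  act-root : ∀ w r → act w (root r) ≋ root (w • r)
  act-root []      r i = ≈-refl
  act-root (s ∷ w) r i = ≈-trans
    (reflection-cong (α s) _ (act-root w r) i) (proj₂ (stable (simple s) (w • r)) i)

  •-cong : ∀ {u w} → u ~ w → ∀ r → u • r ≡ w • r
  •-cong {u} {w} u~w r = injective λ i → begin
    root (u • r) i    ≈⟨ act-root u r i ⟨
    act u (root r) i  ≈⟨ Equivalence.to (faithful u w) u~w (root r) i ⟩
    act w (root r) i  ≈⟨ act-root w r i ⟩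
    root (w • r) i    ∎
    where open SetoidReasoning setoid

  positive⇒¬negative : ∀ {r} → Positive r → ¬ Negative r
  positive⇒¬negative {r} (c , c≥0 , r≋c) (d , d≤0 , r≋d) =
    proj₂ (tight _ _) ‖r‖²≈0 (nonzero r)
    where
    open SetoidReasoning setoid

    c≈d : c ≋ d
    c≈d = independent λ i → ≈-trans (≈-sym (r≋c i)) (r≋d i)

    c≈0 : ∀ i → c i ≈ 0#
    c≈0 i = ≤-antisym (λ 0<ci → d≤0 i (<-respʳ-≈ (c≈d i) 0<ci)) (c≥0 i)

    r≈0 : ∀ i → root r i ≈ 0#
    r≈0 i = begin
      root r i                    ≈⟨ r≋c i ⟩
      sum (λ j → c j * α j i)     ≈⟨ sum-cong-≋ (λ j → ≈-trans (*-congʳ (c≈0 j)) (zeroˡ _)) ⟩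
      sum {n} (λ _ → 0#)          ≈⟨ sum-replicate-zero n ⟩
      0#                          ∎

    ‖r‖²≈0 : ⟨ root r , root r ⟩ ≈ 0#
    ‖r‖²≈0 = begin
      ⟨ root r , root r ⟩         ≈⟨ sum-cong-≋ (λ j → ≈-trans (*-congʳ (r≈0 j)) (zeroˡ _)) ⟩
      sum {n} (λ _ → 0#)          ≈⟨ sum-replicate-zero n ⟩
      0#                          ∎

  negative? : Decidable Negative
  negative? r with sign r
  ... | inj₁ pos = no (positive⇒¬negative pos)
  ... | inj₂ neg = yes neg

  simple-positive : ∀ i → Positive (simple i)
  simple-positive i = unit , unit≥0 , λ k → ≈-sym (sum-unit i (λ j → α j k))
    where
    unitAt : ∀ {k} → Fin k → Vector Carrier k
    unitAt zero    zero    = 1#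
    unitAt zero    (suc _) = 0#
    unitAt (suc _) zero    = 0#
    unitAt (suc i) (suc j) = unitAt i j

    unit : Vector Carrier n
    unit = unitAt i

    unitAt≥0 : ∀ {k} (i j : Fin k) → 0# ≤ unitAt i j
    unitAt≥0 zero    zero    = <-asym 0<1
    unitAt≥0 zero    (suc _) = <-irrefl ≈-refl
    unitAt≥0 (suc _) zero    = <-irrefl ≈-refl
    unitAt≥0 (suc i) (suc j) = unitAt≥0 i j

    unit≥0 : ∀ j → 0# ≤ unit j
    unit≥0 = unitAt≥0 i

    sum-unit : ∀ {k} (i : Fin k) (f : Vector Carrier k) → sum (λ j → unitAt i j * f j) ≈ f i
    sum-unit {suc k} zero f = ≈-trans (+-cong (*-identityˡ _)
      (≈-trans (sum-cong-≋ {k} λ j → zeroˡ _) (sum-replicate-zero k))) (+-identityʳ _)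
    sum-unit (suc i) f = ≈-trans (+-congʳ (zeroˡ _)) (≈-trans (+-identityˡ _) (sum-unit i (f ∘ suc)))

  Des : Word n → Subset n
  Des w = Vec.tabulate λ i → does (negative? (w • simple i))

  X : Subset n → Pred (Word n) 0ℓ
  X J w = Des w ∩ J ≡ ⊥

  X? : ∀ J → Decidable (X J)
  X? J w = (Des w ∩ J) ≟ˢ ⊥

  -- J ⊆ Π as a set of roots, and its image under w.
  ⟦_⟧ : Subset n → Pred (Fin size) 0ℓ
  ⟦ J ⟧ r = ∃[ i ] i ∈ J × simple i ≡ r

  _⟨_⟩ : Word n → Subset n → Pred (Fin size) 0ℓ
  (w ⟨ J ⟩) r = ∃[ s ] ⟦ J ⟧ s × w • s ≡ r

  Πˢ : Pred (Fin size) 0ℓ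
  Πˢ r = ∃[ i ] simple i ≡ r

  infix 4 _∼_ _∼?_

  _∼_ : Rel (Subset n) 0ℓ
  J ∼ K = ∃[ w ] w ⟨ J ⟩ ≐ ⟦ K ⟧

  ⟦_⟧? : ∀ J → Decidable ⟦ J ⟧
  ⟦ J ⟧? r = Fin.any? λ i → (i ∈? J) ×-dec (simple i Fin.≟ r)

  _⟨_⟩? : ∀ w J → Decidable (w ⟨ J ⟩)
  (w ⟨ J ⟩?) r = Fin.any? λ s → ⟦ J ⟧? s ×-dec (w • s Fin.≟ r)

  Πˢ? : Decidable Πˢ
  Πˢ? r = Fin.any? λ i → simple i Fin.≟ r

  private
    ⊆-dec : {P Q : Pred (Fin size) 0ℓ} → Decidable P → Decidable Q → Dec (P U.⊆ Q)
    ⊆-dec P? Q? = map′ (λ f {r} → f r) (λ f r → f {r}) (Fin.all? λ r → P? r →-dec Q? r)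

  _⟨_⟩⊆Πˢ? : ∀ w K → Dec (w ⟨ K ⟩ U.⊆ Πˢ)
  w ⟨ K ⟩⊆Πˢ? = ⊆-dec (w ⟨ K ⟩?) Πˢ?

  representative : Word n → Word n
  representative w = Inverse.to enumeration (Inverse.from enumeration w)

  representative-~ : ∀ w → representative w ~ w
  representative-~ w = Inverse.strictlyInverseˡ enumeration w

  _∼?_ : ∀ J K → Dec (J ∼ K)
  J ∼? K = map′ (λ (k , eq) → Inverse.to enumeration k , eq) transport
    (Fin.any? λ k → let w = Inverse.to enumeration k in
      ⊆-dec (w ⟨ J ⟩?) ⟦ K ⟧? ×-dec ⊆-dec ⟦ K ⟧? (w ⟨ J ⟩?))
    where
    transport : J ∼ K → ∃[ k ] Inverse.to enumeration k ⟨ J ⟩ ≐ ⟦ K ⟧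
    transport (w , w⟨J⟩⊆K , K⊆w⟨J⟩) = Inverse.from enumeration w ,
      (λ (s , s∈J , eq) → w⟨J⟩⊆K (s , s∈J , ≡.trans (≡.sym (•-cong (representative-~ w) s)) eq)) ,
      (λ r∈K → let s , s∈J , eq = K⊆w⟨J⟩ r∈K in s , s∈J , ≡.trans (•-cong (representative-~ w) s) eq)

  ∼-refl : ∀ J → J ∼ J
  ∼-refl J = [] , (λ { (s , s∈J , refl) → s∈J }) , (λ r∈J → _ , r∈J , refl)

  -- An equivalence class λ is given by any of its members: `class J` lists
  -- λ(J), and `classes` has exactly one member of each class.
  class : Subset n → List (Subset n)
  class J = filter (J ∼?_) (subsets n)

  classes : List (Subset n)
  classes = deduplicate _∼?_ (subsets n)

  instance
    class-nonZero : ∀ {J} → ℕ.NonZero (length (class J))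
    class-nonZero {J} = card-nonZero (J ∼?_) (∈-subsets J) (∼-refl J)

  stabilizing? : ∀ J K → Decidable (λ w → X J w × w ⟨ K ⟩ U.⊆ Πˢ)
  stabilizing? J K w = X? J w ×-dec w ⟨ K ⟩⊆Πˢ?

  μ : Matrix n
  μ J K = if does (K ⊆? J)
          then ℤ.+ card (stabilizing? J K) elements ℚ./ length (class K)
          else 0ℚ

  μ-triangular : ∀ {J K} → ¬ K ⊆ J → μ J K ≡ 0ℚ
  μ-triangular {J} {K} K⊈J = if-false (dec-false (K ⊆? J) K⊈J)

  μ-diagonal : ∀ J → μ J J ≢ 0ℚ
  μ-diagonal J μJJ≡0 = /-≢0 (card (stabilizing? J J) elements) (length (class J))
    {{card-nonZero (stabilizing? J J) w∈W (Xw , w⟨J⟩⊆Π)}} {{class-nonZero {J}}}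
    (≡.trans (≡.sym (if-true (dec-true (J ⊆? J) ⊆-refl))) μJJ≡0)
    where
    w = representative []

    w∈W : w List.∈ elements
    w∈W = List.∈-tabulate⁺ (Inverse.from enumeration [])

    w•r≡r : ∀ r → w • r ≡ r
    w•r≡r = •-cong (representative-~ [])

    w⟨J⟩⊆Π : w ⟨ J ⟩ U.⊆ Πˢ
    w⟨J⟩⊆Π (s , (i , _ , eq) , refl) = i , ≡.trans eq (≡.sym (w•r≡r s))

    Xw : X J w
    Xw = begin
      Des w ∩ J  ≡⟨ cong (_∩ J) (≡.trans (Vec.tabulate-cong ¬des) tabulate-outside) ⟩
      ⊥ ∩ J      ≡⟨ ∩-zeroˡ J ⟩
      ⊥          ∎
      where
      open ≡-Reasoning
      tabulate-outside : ∀ {k} → Vec.tabulate {n = k} (λ _ → outside) ≡ ⊥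
      tabulate-outside {zero}  = refl
      tabulate-outside {suc k} = cong (outside ∷_) tabulate-outside

      ¬des : ∀ i → does (negative? (w • simple i)) ≡ outside
      ¬des i = dec-false (negative? (w • simple i))
        (≡.subst (¬_ ∘ Negative) (≡.sym (w•r≡r (simple i))) (positive⇒¬negative (simple-positive i)))

  opaque
    μ-invertible : ∃[ B ] IsInverse μ B
    μ-invertible = triangular⇒invertible μ μ-triangular μ-diagonal

  β : Matrix n
  β = proj₁ μ-invertible

  -- An element of a group algebra is given by its coefficients.
  x : Subset n → Word n → ℚ
  x J w = if does (X? J w) then 1ℚ else 0ℚ

  -- e J is the idempotent of the class of J.
  e : Subset n → Word n → ℚ
  e J₀ w = ℤ.+ 1 ℚ./ length (class J₀) ℚ.*
           (∑[ J ∈ class J₀ ] ∑[ K ∈ filter (_⊆? J) (subsets n) ] β J K ℚ.* x K w)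

  -- M_{W,y} = ∑_λ e_λ / y^‖λ‖
  M : ∀ {y} → y # 0# → Word n → Carrier
  M y#0 w = ∑ᴿ classes λ J → fromℚ (e J w) * (y#0 ⁻¹ᴿ) ^ ∣ J ∣
    where open ListSum commutativeRing renaming (∑ to ∑ᴿ)

record IsSignedProbabilityMeasure (ℝ : RealNumbers c ℓ₁ ℓ₂ ℓ₃) {n} (W : FiniteCoxeterGroup n)
       (f : Word n → RealNumbers.Carrier ℝ) : Set (c ⊔ ℓ₁) where
  open RealNumbers ℝ using (1#; commutativeRing) renaming (_≈_ to _≈ᴿ_)
  open FiniteCoxeterGroup W
  field
    f-cong : ∀ {u w} → u ≈ w → f u ≈ᴿ f w
    total  : ListSum.∑ commutativeRing elements f ≈ᴿ 1#

-- Summing over W, the augmentation of x_K is |X_K| = μ_∅^K, as λ(∅) = {∅}.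
-- Since β inverts μ, and is triangular like μ, the augmentation of
-- ∑_{K ⊆ J} β_K^J x_K is therefore (βμ)_{J,∅} = δ_{J,∅}, so e_∅ has augmentation 1 and every other e_λ has
-- augmentation 0.  Only the term x^{-‖∅‖} = 1 survives in ∑_w M_{W,x}(w).

{-# OPTIONS --safe #-}
module Submission where

open import Defs
open import Level using (Level)
open import Data.Nat using (ℕ)

open import Algebra.Bundles using (CommutativeRing)
import Algebra.Properties.AbelianGroup as AbelianGroupProperties
import Algebra.Properties.CommutativeSemigroup as CommutativeSemigroupProperties
import Algebra.Properties.Monoid.Mult as MonoidMult
import Algebra.Properties.Ring as RingProperties
import Algebra.Properties.Semiring.Mult as SemiringMult
open import Data.Bool.Base using (if_then_else_)
import Data.Fin.Properties as Fin
open import Data.Fin.Subset using (Subset; inside; outside; _⊆_; _⊂_; _∩_; ⊥; ∣_∣)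
open import Data.Fin.Subset.Induction using (⊂-wellFounded)
open import Data.Fin.Subset.Properties
  using (_⊆?_; _∈?_; ∉⊥; ⊥⊆; Empty-unique; ∣⊥∣≡0; ⊆-antisym; ⊆-trans)
open import Data.Integer.Base as ℤ using (ℤ; -[1+_])
import Data.Integer.Properties as ℤ
open import Data.List.Base as List using (List; []; _∷_; map; filter; length; deduplicate)
open import Data.List.Membership.Propositional using () renaming (_∈_ to _∈ˡ_)
open import Data.List.Membership.Propositional.Properties using (∈-filter⁺; ∈-map⁻)
import Data.List.Properties as List
open import Data.List.Relation.Unary.All as All using (All; []; _∷_)
import Data.List.Relation.Unary.All.Properties as All
open import Data.List.Relation.Unary.AllPairs using ([]; _∷_)
open import Data.List.Relation.Unary.Any using (here; there)
open import Data.List.Relation.Unary.Unique.Propositional using (Unique)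
import Data.List.Relation.Unary.Unique.Propositional.Properties as Unique
open import Data.Nat.Base as ℕ using (zero; suc)
open import Data.Nat.Coprimality using (1-coprimeTo) renaming (sym to coprime-sym)
import Data.Nat.Properties as ℕ
open import Data.Product.Base using (_×_; _,_; proj₁; proj₂)
open import Data.Rational.Base as ℚ using (ℚ; 0ℚ; 1ℚ; mkℚ)
import Data.Rational.Properties as ℚ
open import Data.Rational.Unnormalised.Base using (*≡*)
import Data.Vec.Base as Vec
import Data.Vec.Properties as Vec
open import Function.Base using (_∘_)
open import Induction.WellFounded using (Acc; acc)
import Relation.Binary.Reasoning.Setoid as SetoidReasoning
open import Relation.Binary.Core using (Rel)
open import Relation.Binary.Definitions using (Reflexive) renaming (Decidable to Decidable₂)
open import Relation.Binary.PropositionalEquality as ≡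
  using (_≡_; _≢_; refl; cong; cong₂; module ≡-Reasoning)
open import Relation.Nullary using (¬_; yes; no; does; contradiction)
open import Relation.Nullary.Decidable using (dec-true; dec-false; ¬?; decidable-stable; _×-dec_)
open import Relation.Unary using (Pred; Decidable)

private variable
  a b c p ℓ ℓ₁ ℓ₂ ℓ₃ : Level
  A B : Set a
  n : ℕ

-- Lists without repetition.

filter-unique : {P : Pred A p} (P? : Decidable P) {x : A} {xs : List A} → Unique xs → x ∈ˡ xs →
                P x → (∀ {y} → P y → y ≡ x) → filter P? xs ≡ x ∷ []
filter-unique P? (x∉xs ∷ _) (here refl) px only = ≡.trans (List.filter-accept P? px)
  (cong (_ ∷_) (List.filter-none P? (All.map (λ x≢y py → x≢y (≡.sym (only py))) x∉xs)))
filter-unique P? (y∉xs ∷ !xs) (there x∈xs) px only = ≡.trans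
  (List.filter-reject P? (All.lookup y∉xs x∈xs ∘ only))
  (filter-unique P? !xs x∈xs px only)

module _ {R : Rel A ℓ} (R? : Decidable₂ R) where

  -- Every element kept after `x` is unrelated to `x` by `R`; reflexivity turns this into
  -- inequality.
  deduplicate-! : Reflexive R → ∀ xs → Unique (deduplicate R? xs)
  deduplicate-! R-refl []       = []
  deduplicate-! R-refl (x ∷ xs) =
    All.map (λ { ¬Rxy refl → ¬Rxy R-refl }) (All.all-filter (¬? ∘ R? x) (deduplicate R? xs)) ∷
    Unique.filter⁺ (¬? ∘ R? x) (deduplicate-! R-refl xs)

  -- An element is dropped only in favour of an earlier element related to it, and by the premise
  -- such an element is `x` itself. This ensures that the list `classes` represents the class of `⊥`
  -- by `⊥`.
  ∈-deduplicate⁺ : ∀ {x xs} → (∀ {y} → R y x → y ≡ x) → x ∈ˡ xs → x ∈ˡ deduplicate R? xs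
  ∈-deduplicate⁺             only (here refl)  = here refl
  ∈-deduplicate⁺ {x} {y ∷ _} only (there x∈xs) with R? y x
  ... | yes Ryx = here (≡.sym (only Ryx))
  ... | no ¬Ryx = there (∈-filter⁺ (¬? ∘ R? y) (∈-deduplicate⁺ only x∈xs) ¬Ryx)

subsets-! : ∀ n → Unique (subsets n)
subsets-! zero    = [] ∷ []
subsets-! (suc n) = Unique.++⁺ (Unique.map⁺ Vec.∷-injectiveʳ (subsets-! n))
  (Unique.map⁺ Vec.∷-injectiveʳ (subsets-! n)) disjoint
  where
  disjoint : ∀ {J} → ¬ (J ∈ˡ map (inside Vec.∷_) (subsets n) × J ∈ˡ map (outside Vec.∷_) (subsets n))
  disjoint (J∈₁ , J∈₂) with ∈-map⁻ _ J∈₁ | ∈-map⁻ _ J∈₂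
  ... | _ , _ , refl | _ , _ , ()

-- Finite sums in a commutative ring.

module ListSumProperties (R : CommutativeRing c ℓ) where
  open CommutativeRing R renaming (refl to ≈-refl; sym to ≈-sym; trans to ≈-trans)
  open ListSum R
  open CommutativeSemigroupProperties +-commutativeSemigroup using (interchange)
  open SetoidReasoning setoid

  sum-cong : (xs : List A) {f g : A → Carrier} → (∀ x → f x ≈ g x) → ∑ xs f ≈ ∑ xs g
  sum-cong []       f≈g = ≈-refl
  sum-cong (x ∷ xs) f≈g = +-cong (f≈g x) (sum-cong xs f≈g)

  sum-zero : {xs : List A} {f : A → Carrier} → All (λ x → f x ≈ 0#) xs → ∑ xs f ≈ 0#
  sum-zero []           = ≈-refl
  sum-zero (fx≈0 ∷ f≈0) = ≈-trans (+-cong fx≈0 (sum-zero f≈0)) (+-identityˡ 0#)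

  sum-+ : (xs : List A) (f g : A → Carrier) → ∑ xs (λ x → f x + g x) ≈ ∑ xs f + ∑ xs g
  sum-+ []       f g = ≈-sym (+-identityˡ 0#)
  sum-+ (x ∷ xs) f g = ≈-trans (+-congˡ (sum-+ xs f g)) (interchange (f x) (g x) _ _)

  sum-swap : (xs : List A) (ys : List B) (f : A → B → Carrier) →
             ∑ xs (λ x → ∑ ys (f x)) ≈ ∑ ys (λ y → ∑ xs (λ x → f x y))
  sum-swap []       ys f = ≈-sym (sum-zero (All.universal (λ _ → ≈-refl) ys))
  sum-swap (x ∷ xs) ys f = ≈-trans (+-congˡ (sum-swap xs ys f)) (≈-sym (sum-+ ys _ _))

  sum-*ʳ : (xs : List A) (f : A → Carrier) (r : Carrier) → ∑ xs (λ x → f x * r) ≈ ∑ xs f * r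
  sum-*ʳ []       f r = ≈-sym (zeroˡ r)
  sum-*ʳ (x ∷ xs) f r = ≈-trans (+-congˡ (sum-*ʳ xs f r)) (≈-sym (distribʳ r (f x) _))

  -- Uniqueness ensures that the one surviving term is counted once.
  sum-concentrated : {x : A} {xs : List A} {f : A → Carrier} → Unique xs → x ∈ˡ xs →
                     (∀ y → y ≢ x → f y ≈ 0#) → ∑ xs f ≈ f x
  sum-concentrated {f = f} (x∉xs ∷ _) (here refl) f≈0 = ≈-trans
    (+-congˡ (sum-zero (All.map (λ x≢y → f≈0 _ (x≢y ∘ ≡.sym)) x∉xs))) (+-identityʳ (f _))
  sum-concentrated (y∉xs ∷ !xs) (there x∈xs) f≈0 = ≈-trans
    (+-cong (f≈0 _ (All.lookup y∉xs x∈xs)) (sum-concentrated !xs x∈xs f≈0)) (+-identityˡ _)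

  -- Serves to extend a sum over the `K ⊆ J` to all subsets, where it becomes an entry of a matrix
  -- product.
  sum-filter : {P : Pred A p} (P? : Decidable P) (xs : List A) {f : A → Carrier} →
               (∀ x → ¬ P x → f x ≈ 0#) → ∑ (filter P? xs) f ≈ ∑ xs f
  sum-filter P? []       f≈0 = ≈-refl
  sum-filter P? (x ∷ xs) f≈0 with P? x
  ... | yes _  = +-congˡ (sum-filter P? xs f≈0)
  ... | no ¬px = ≈-trans (sum-filter P? xs f≈0)
    (≈-trans (≈-sym (+-identityˡ _)) (+-congʳ (≈-sym (f≈0 x ¬px))))

module ℚ-Sum = ListSumProperties ℚ.+-*-commutativeRing
open ListSum ℚ.+-*-commutativeRing

-- Counting with rational numbers.

1+k/1 : ∀ k → 1ℚ ℚ.+ ℤ.+ k ℚ./ 1 ≡ ℤ.+ suc k ℚ./ 1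
1+k/1 k = begin
  -- For a variable `k` the normalisation in `k / 1` is stuck on a gcd. The explicit form `mkℚ` lets
  -- the addition compute.
  1ℚ ℚ.+ ℤ.+ k ℚ./ 1         ≡⟨ cong (1ℚ ℚ.+_) (ℚ.normalize-coprime k⊥1) ⟩
  1ℚ ℚ.+ mkℚ (ℤ.+ k) 0 k⊥1   ≡⟨ cong (λ i → (ℤ.+ 1 ℤ.+ i) ℚ./ 1) (ℤ.*-identityʳ (ℤ.+ k)) ⟩
  ℤ.+ suc k ℚ./ 1            ∎
  where
  open ≡-Reasoning
  k⊥1 = coprime-sym (1-coprimeTo k)

sum-indicator : {P : Pred A p} (P? : Decidable P) (xs : List A) →
                ∑ xs (λ x → if does (P? x) then 1ℚ else 0ℚ) ≡ ℤ.+ card P? xs ℚ./ 1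
sum-indicator P? []       = refl
sum-indicator P? (x ∷ xs) with P? x
... | yes _ = ≡.trans (cong (1ℚ ℚ.+_) (sum-indicator P? xs)) (1+k/1 (card P? xs))
... | no  _ = ≡.trans (ℚ.+-identityˡ _) (sum-indicator P? xs)

-- Inverses of triangular matrices.

p*q≡0⇒q≡0 : ∀ p q → p ≢ 0ℚ → p ℚ.* q ≡ 0ℚ → q ≡ 0ℚ
p*q≡0⇒q≡0 p q p≢0 pq≡0 = begin
  q                        ≡⟨ ℚ.*-identityˡ q ⟨
  1ℚ ℚ.* q                 ≡⟨ cong (ℚ._* q) (ℚ.*-inverseˡ p) ⟨
  ℚ.1/ p ℚ.* p ℚ.* q       ≡⟨ ℚ.*-assoc (ℚ.1/ p) p q ⟩
  ℚ.1/ p ℚ.* (p ℚ.* q)     ≡⟨ cong (ℚ.1/ p ℚ.*_) pq≡0 ⟩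
  ℚ.1/ p ℚ.* 0ℚ            ≡⟨ ℚ.*-zeroʳ (ℚ.1/ p) ⟩
  0ℚ                       ∎
  where
  open ≡-Reasoning
  instance _ = ℚ.≢-nonZero p≢0

⊆∧≢⇒⊂ : {I J : Subset n} → I ⊆ J → I ≢ J → I ⊂ J
⊆∧≢⇒⊂ {I = I} {J} I⊆J I≢J with Fin.any? (λ i → (i ∈? J) ×-dec ¬? (i ∈? I))
... | yes (i , i∈J , i∉I) = I⊆J , i , i∈J , i∉I
-- The search found no element of `J` outside `I`; as membership is decidable, this gives `J ⊆ I`.
... | no ∄i = contradiction
  (⊆-antisym I⊆J λ {i} i∈J → decidable-stable (i ∈? I) λ i∉I → ∄i (i , i∈J , i∉I)) I≢J

-- By induction on J, the entry at J, K of A B = 1 reads A_JJ B_JK = 0.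
inverse-triangular : {A B : Matrix n} → A ⊗ B ≗₂ identityMatrix →
                     (∀ {J K} → ¬ K ⊆ J → A J K ≡ 0ℚ) → (∀ J → A J J ≢ 0ℚ) →
                     ∀ {J K} → ¬ K ⊆ J → B J K ≡ 0ℚ
inverse-triangular {n} {A} {B} AB≗1 triangular diagonal {J} {K} = go J (⊂-wellFounded J)
  where
  go : ∀ J → Acc _⊂_ J → ¬ K ⊆ J → B J K ≡ 0ℚ
  go J (acc rec) K⊈J = p*q≡0⇒q≡0 (A J J) (B J K) (diagonal J) (begin
    A J J ℚ.* B J K                               ≡⟨ ℚ-Sum.sum-concentrated (subsets-! n) (∈-subsets J) offDiagonal ⟨
    (A ⊗ B) J K                                   ≡⟨ AB≗1 J K ⟩
    identityMatrix J K                            ≡⟨ if-false (dec-false (J ≟ˢ K) λ { refl → K⊈J (λ x → x) }) ⟩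
    0ℚ                                            ∎)
    where
    open ≡-Reasoning
    offDiagonal : ∀ L → L ≢ J → A J L ℚ.* B L K ≡ 0ℚ
    offDiagonal L L≢J with L ⊆? J
    ... | no L⊈J  = ≡.trans (cong (ℚ._* B L K) (triangular L⊈J)) (ℚ.*-zeroˡ (B L K))
    ... | yes L⊆J = ≡.trans
      (cong (A J L ℚ.*_) (go L (rec (⊆∧≢⇒⊂ L⊆J L≢J)) (λ K⊆L → K⊈J (⊆-trans K⊆L L⊆J))))
      (ℚ.*-zeroʳ (A J L))

-- The additive embedding of ℚ into the real numbers.

module RealNumbersProperties (ℝ : RealNumbers c ℓ₁ ℓ₂ ℓ₃) where
  open RealNumbers ℝ
  open CommutativeRing commutativeRing using (ring; +-abelianGroup; +-commutativeSemigroup)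
  open AbelianGroupProperties +-abelianGroup using (⁻¹-∙-comm; ε⁻¹≈ε; ⁻¹-involutive)
  open RingProperties ring using (-‿distribˡ-*)
  open SetoidReasoning setoid

  inverseˡ : ∀ {x} (x#0 : x # 0#) → x#0 ⁻¹ * x ≈ 1#
  inverseˡ {x} x#0 = ≈-trans
    -- The element provided by `#⇒invertible` is an inverse of `x - 0#`, so `x` is first brought
    -- into that form.
    (*-congˡ (≈-sym (≈-trans (+-congˡ ε⁻¹≈ε) (+-identityʳ x))))
    (proj₁ (proj₂ (#⇒invertible x#0)))

  fromℕ-+ : ∀ m n → fromℕ (m ℕ.+ n) ≈ fromℕ m + fromℕ n
  fromℕ-+ = MonoidMult.×-homo-+ +-monoid 1#

  fromℕ-* : ∀ m n → fromℕ (m ℕ.* n) ≈ fromℕ m * fromℕ n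
  fromℕ-* = SemiringMult.×1-homo-* semiring

  -- Integer addition with mixed signs computes through `⊖`, so these cases of `fromℤ-+` rest on
  -- this lemma.
  fromℤ-⊖ : ∀ m n → fromℤ (m ℤ.⊖ n) ≈ fromℕ m + - fromℕ n
  fromℤ-⊖ m       zero    = ≈-sym (≈-trans (+-congˡ ε⁻¹≈ε) (+-identityʳ _))
  fromℤ-⊖ zero    (suc n) = ≈-sym (+-identityˡ _)
  fromℤ-⊖ (suc m) (suc n) = begin
    fromℤ (suc m ℤ.⊖ suc n)                   ≡⟨ cong fromℤ (ℤ.[1+m]⊖[1+n]≡m⊖n m n) ⟩
    fromℤ (m ℤ.⊖ n)                           ≈⟨ fromℤ-⊖ m n ⟩
    fromℕ m + - fromℕ n                       ≈⟨ +-identityˡ _ ⟨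
    -- Inserting `1# + - 1#` and regrouping restores the two successors.
    0# + (fromℕ m + - fromℕ n)                ≈⟨ +-congʳ (-‿inverseʳ 1#) ⟨
    1# + - 1# + (fromℕ m + - fromℕ n)         ≈⟨ interchange 1# (- 1#) (fromℕ m) (- fromℕ n) ⟩
    1# + fromℕ m + (- 1# + - fromℕ n)         ≈⟨ +-congˡ (⁻¹-∙-comm 1# (fromℕ n)) ⟩
    fromℕ (suc m) + - fromℕ (suc n)           ∎
    where open CommutativeSemigroupProperties +-commutativeSemigroup using (interchange)

  fromℤ-+ : ∀ i j → fromℤ (i ℤ.+ j) ≈ fromℤ i + fromℤ j
  fromℤ-+ (ℤ.+ m)  (ℤ.+ n)  = fromℕ-+ m n
  fromℤ-+ (ℤ.+ m)  -[1+ n ] = fromℤ-⊖ m (suc n)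
  fromℤ-+ -[1+ m ] (ℤ.+ n)  = ≈-trans (fromℤ-⊖ n (suc m)) (+-comm _ _)
  fromℤ-+ -[1+ m ] -[1+ n ] = begin
    - fromℕ (suc (suc (m ℕ.+ n)))             ≡⟨ cong (-_ ∘ fromℕ ∘ suc) (ℕ.+-suc m n) ⟨
    - fromℕ (suc m ℕ.+ suc n)                 ≈⟨ -‿cong (fromℕ-+ (suc m) (suc n)) ⟩
    - (fromℕ (suc m) + fromℕ (suc n))         ≈⟨ ⁻¹-∙-comm _ _ ⟨
    - fromℕ (suc m) + - fromℕ (suc n)         ∎

  fromℤ-neg : ∀ i → fromℤ (ℤ.- i) ≈ - fromℤ i
  fromℤ-neg (ℤ.+ zero)  = ≈-sym ε⁻¹≈ε
  fromℤ-neg (ℤ.+ suc n) = ≈-refl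
  fromℤ-neg -[1+ n ]    = ≈-sym (⁻¹-involutive _)

  -- The second factor is a natural number because it will be a denominator, or a product of
  -- denominators, in a cross-multiplication.
  fromℤ-*-fromℕ : ∀ i n → fromℤ (i ℤ.* ℤ.+ n) ≈ fromℤ i * fromℕ n
  fromℤ-*-fromℕ (ℤ.+ m) n = begin
    fromℤ (ℤ.+ m ℤ.* ℤ.+ n)                   ≡⟨ cong fromℤ (ℤ.pos-* m n) ⟨
    fromℕ (m ℕ.* n)                           ≈⟨ fromℕ-* m n ⟩
    fromℕ m * fromℕ n                         ∎
  fromℤ-*-fromℕ -[1+ m ] n = begin
    fromℤ (-[1+ m ] ℤ.* ℤ.+ n)                ≡⟨ cong fromℤ (ℤ.neg-distribˡ-* (ℤ.+ suc m) (ℤ.+ n)) ⟨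
    fromℤ (ℤ.- (ℤ.+ suc m ℤ.* ℤ.+ n))         ≈⟨ fromℤ-neg (ℤ.+ suc m ℤ.* ℤ.+ n) ⟩
    - fromℤ (ℤ.+ suc m ℤ.* ℤ.+ n)             ≈⟨ -‿cong (fromℤ-*-fromℕ (ℤ.+ suc m) n) ⟩
    - (fromℕ (suc m) * fromℕ n)               ≈⟨ -‿distribˡ-* _ _ ⟩
    - fromℕ (suc m) * fromℕ n                 ∎

  fromℚ-↧ : ∀ q → fromℚ q * fromℕ (ℚ.↧ₙ q) ≈ fromℤ (ℚ.↥ q)
  fromℚ-↧ q = ≈-trans (*-assoc _ _ _)
    (≈-trans (*-congˡ (inverseˡ (fromℕ-suc#0 (ℚ.denominator-1 q)))) (*-identityʳ _))

  fromℕ-suc-cancelʳ : ∀ k {x y} → x * fromℕ (suc k) ≈ y * fromℕ (suc k) → x ≈ y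
  fromℕ-suc-cancelʳ k {x} {y} xk≈yk = begin
    x                             ≈⟨ undo x ⟨
    x * fromℕ (suc k) * k⁻¹       ≈⟨ *-congʳ xk≈yk ⟩
    y * fromℕ (suc k) * k⁻¹       ≈⟨ undo y ⟩
    y                             ∎
    where
    k⁻¹ = fromℕ-suc#0 k ⁻¹
    undo : ∀ z → z * fromℕ (suc k) * k⁻¹ ≈ z
    undo z = ≈-trans (*-assoc _ _ _)
      (≈-trans (*-congˡ (≈-trans (*-comm _ _) (inverseˡ (fromℕ-suc#0 k)))) (*-identityʳ z))

  -- The sum is stored in lowest terms, so its numerator need not be the one from the usual formula
  -- for adding fractions. What is available is the cross-multiplied identity in ℤ from
  -- `toℚᵘ-homo-+`; it is transported to the field, where the denominators cancel.
  fromℚ-+ : ∀ p q → fromℚ (p ℚ.+ q) ≈ fromℚ p + fromℚ q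
  fromℚ-+ p@(mkℚ i k _) q@(mkℚ j l _) with p ℚ.+ q | ℚ.toℚᵘ-homo-+ p q
  -- The product `suc k * suc l` reduces to a successor, so the `suc` of its `pred` is the product
  -- again and the cancellation lemma applies to it.
  ... | r@(mkℚ h m _) | *≡* cross = fromℕ-suc-cancelʳ m (fromℕ-suc-cancelʳ (ℕ.pred (suc k ℕ.* suc l)) (begin
    fromℚ r * m′ * k′l′
      ≈⟨ *-congʳ (fromℚ-↧ r) ⟩
    fromℤ h * k′l′
      ≈⟨ fromℤ-*-fromℕ h (suc k ℕ.* suc l) ⟨
    fromℤ (h ℤ.* (ℤ.+ (suc k ℕ.* suc l)))
      ≡⟨ cong fromℤ cross ⟩
    fromℤ ((i ℤ.* ℤ.+ suc l ℤ.+ j ℤ.* ℤ.+ suc k) ℤ.* ℤ.+ suc m)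
      ≈⟨ fromℤ-*-fromℕ (i ℤ.* ℤ.+ suc l ℤ.+ j ℤ.* ℤ.+ suc k) (suc m) ⟩
    fromℤ (i ℤ.* ℤ.+ suc l ℤ.+ j ℤ.* ℤ.+ suc k) * m′
      ≈⟨ *-congʳ (fromℤ-+ (i ℤ.* ℤ.+ suc l) (j ℤ.* ℤ.+ suc k)) ⟩
    (fromℤ (i ℤ.* ℤ.+ suc l) + fromℤ (j ℤ.* ℤ.+ suc k)) * m′
      ≈⟨ *-congʳ (+-cong (fromℤ-*-fromℕ i (suc l)) (fromℤ-*-fromℕ j (suc k))) ⟩
    (fromℤ i * l′ + fromℤ j * k′) * m′
      ≈⟨ *-congʳ (+-cong (*-congʳ (fromℚ-↧ p)) (*-congʳ (fromℚ-↧ q))) ⟨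
    (fromℚ p * k′ * l′ + fromℚ q * l′ * k′) * m′
      ≈⟨ *-congʳ (+-cong (*-assoc _ _ _) (≈-trans (*-assoc _ _ _) (*-congˡ (*-comm l′ k′)))) ⟩
    (fromℚ p * (k′ * l′) + fromℚ q * (k′ * l′)) * m′
      ≈⟨ *-congʳ (distribʳ (k′ * l′) (fromℚ p) (fromℚ q)) ⟨
    (fromℚ p + fromℚ q) * (k′ * l′) * m′
      ≈⟨ *-congʳ (*-congˡ (fromℕ-* (suc k) (suc l))) ⟨
    (fromℚ p + fromℚ q) * k′l′ * m′
      ≈⟨ *-assoc _ _ _ ⟩
    (fromℚ p + fromℚ q) * (k′l′ * m′)
      ≈⟨ *-congˡ (*-comm k′l′ m′) ⟩
    (fromℚ p + fromℚ q) * (m′ * k′l′)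
      ≈⟨ *-assoc _ _ _ ⟨
    (fromℚ p + fromℚ q) * m′ * k′l′  ∎))
    where
    k′   = fromℕ (suc k)
    l′   = fromℕ (suc l)
    m′   = fromℕ (suc m)
    k′l′ = fromℕ (suc k ℕ.* suc l)

  fromℚ-0 : fromℚ 0ℚ ≈ 0#
  fromℚ-0 = zeroˡ _

  fromℚ-1 : fromℚ 1ℚ ≈ 1#
  fromℚ-1 = ≈-trans (*-comm _ _) (inverseˡ (fromℕ-suc#0 0))

  fromℚ-∑ : (xs : List A) (f : A → ℚ) →
            fromℚ (∑ xs f) ≈ ListSum.∑ commutativeRing xs (fromℚ ∘ f)
  fromℚ-∑ []       f = fromℚ-0
  fromℚ-∑ (x ∷ xs) f = ≈-trans (fromℚ-+ (f x) _) (+-congˡ (fromℚ-∑ xs f))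

-- Augmentations of the elements `x R K` and `e R J`.

module _ {ℝ : RealNumbers c ℓ₁ ℓ₂ ℓ₃} {W : FiniteCoxeterGroup n} (R : ReflectionRepresentation ℝ W) where
  open FiniteCoxeterGroup W using (elements) renaming (_≈_ to _~_)
  open ReflectionRepresentation R using (simple)

  -- If `i ∈ J`, then the root `w • simple i` would lie in the empty set `⟦ ⊥ ⟧`.
  ∼⊥⇒≡⊥ : ∀ {J} → _∼_ R J ⊥ → J ≡ ⊥
  ∼⊥⇒≡⊥ (w , wJ⊆⊥ , _) = Empty-unique λ (i , i∈J) →
    let _ , j∈⊥ , _ = wJ⊆⊥ (simple i , (i , i∈J , refl) , refl) in ∉⊥ j∈⊥

  ⊥∼⇒≡⊥ : ∀ {K} → _∼_ R ⊥ K → K ≡ ⊥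
  ⊥∼⇒≡⊥ (w , _ , K⊆w⊥) = Empty-unique λ (i , i∈K) →
    let _ , (_ , j∈⊥ , _) , _ = K⊆w⊥ (i , i∈K , refl) in ∉⊥ j∈⊥

  -- This makes the denominator `length (class R ⊥)` equal to 1, both in `μ R K ⊥` and in `e R ⊥`.
  class-⊥ : class R ⊥ ≡ ⊥ ∷ []
  class-⊥ = filter-unique (_∼?_ R ⊥) (subsets-! n) (∈-subsets ⊥) (∼-refl R ⊥) ⊥∼⇒≡⊥

  μ-⊆ : ∀ {J K} → K ⊆ J →
        μ R J K ≡ (ℤ.+ card (stabilizing? R J K) elements ℚ./ length (class R K)) {{class-nonZero R {K}}}
  μ-⊆ {J} {K} K⊆J = if-true (dec-true (K ⊆? J) K⊆J)

  -- The left side counts `X R K`. The condition that `w` maps the empty set into the simple roots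
  -- is vacuous, so the numerator of `μ R K ⊥` counts the same words, and its denominator is 1.
  ∑-x : ∀ K → ∑ elements (x R K) ≡ μ R K ⊥
  ∑-x K = begin
    ∑ elements (x R K)                                                  ≡⟨ sum-indicator (X? R K) elements ⟩
    ℤ.+ card (X? R K) elements ℚ./ 1                                    ≡⟨ cardinality ⟩
    ℤ.+ card (stabilizing? R K ⊥) elements ℚ./ length (class R (⊥ {n})) ≡⟨ μ-⊆ ⊥⊆ ⟨
    μ R K ⊥                                                             ∎
    where
    open ≡-Reasoning
    instance _ = class-nonZero R {⊥}
    X≡stabilizing : filter (X? R K) elements ≡ filter (stabilizing? R K ⊥) elements
    X≡stabilizing = List.filter-≐ (X? R K) (stabilizing? R K ⊥)
      ((λ Xw → Xw , λ { (_ , (_ , j∈⊥ , _) , _) → contradiction j∈⊥ ∉⊥ }) , proj₁) elements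
    cardinality : ℤ.+ card (X? R K) elements ℚ./ 1 ≡
                  ℤ.+ card (stabilizing? R K ⊥) elements ℚ./ length (class R (⊥ {n}))
    cardinality = ℚ./-cong
      {ℤ.+ card (X? R K) elements} {1} {ℤ.+ card (stabilizing? R K ⊥) elements} {length (class R ⊥)}
      (cong (ℤ.+_ ∘ length) X≡stabilizing) (cong length (≡.sym class-⊥))

  -- As `μ-invertible` is opaque, the block form of the inverse is hidden; triangularity is
  -- recovered from the equation `μ ⊗ β = 1`.
  β-triangular : ∀ {J K} → ¬ K ⊆ J → β R J K ≡ 0ℚ
  β-triangular = inverse-triangular {A = μ R} {B = β R} (proj₁ (proj₂ (μ-invertible R)))
    (μ-triangular R) (μ-diagonal R)

  -- The inner sum in `e`: each `e_λ` is the average of these elements over the `J` in the class.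
  βx : Subset n → Word n → ℚ
  βx J w = ∑ (filter (_⊆? J) (subsets n)) λ K → β R J K ℚ.* x R K w

  ∑-βx : ∀ J → ∑ elements (βx J) ≡ identityMatrix J ⊥
  ∑-βx J = begin
    ∑ elements (βx J)                                   ≡⟨ ℚ-Sum.sum-swap elements Ks (λ w K → β R J K ℚ.* x R K w) ⟩
    ∑ Ks (λ K → ∑ elements λ w → β R J K ℚ.* x R K w)   ≡⟨ ∑-cong Ks (λ K → ∑-*ˡ (β R J K) elements (x R K)) ⟨
    ∑ Ks (λ K → β R J K ℚ.* ∑ elements (x R K))         ≡⟨ ∑-cong Ks (λ K → cong (β R J K ℚ.*_) (∑-x K)) ⟩
    -- Triangularity of `β` makes the terms with `K` outside `J` vanish, so the sum over all subsets
    -- is the same. The next step uses `β ⊗ μ = 1`, the other one of the two inverse equations.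
    ∑ Ks (λ K → β R J K ℚ.* μ R K ⊥)                    ≡⟨ ℚ-Sum.sum-filter (_⊆? J) (subsets n) vanishes ⟩
    (β R ⊗ μ R) J ⊥                                     ≡⟨ proj₂ (proj₂ (μ-invertible R)) J ⊥ ⟩
    identityMatrix J ⊥                                  ∎
    where
    open ≡-Reasoning
    Ks = filter (_⊆? J) (subsets n)
    vanishes : ∀ K → ¬ K ⊆ J → β R J K ℚ.* μ R K ⊥ ≡ 0ℚ
    vanishes K K⊈J = ≡.trans (cong (ℚ._* μ R K ⊥) (β-triangular K⊈J)) (ℚ.*-zeroˡ (μ R K ⊥))

  1/∣class∣ : Subset n → ℚ
  1/∣class∣ J = (ℤ.+ 1 ℚ./ length (class R J)) {{class-nonZero R {J}}}

  ∑-e : ∀ J₀ → ∑ elements (e R J₀) ≡ 1/∣class∣ J₀ ℚ.* ∑ (class R J₀) (λ J → identityMatrix J ⊥)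
  ∑-e J₀ = begin
    ∑ elements (λ w → 1/∣class∣ J₀ ℚ.* ∑ Js λ J → βx J w) ≡⟨ ∑-*ˡ (1/∣class∣ J₀) elements (λ w → ∑ Js λ J → βx J w) ⟨
    1/∣class∣ J₀ ℚ.* ∑ elements (λ w → ∑ Js λ J → βx J w)
      ≡⟨ cong (1/∣class∣ J₀ ℚ.*_) (ℚ-Sum.sum-swap elements Js (λ w J → βx J w)) ⟩
    1/∣class∣ J₀ ℚ.* ∑ Js (λ J → ∑ elements (βx J))       ≡⟨ cong (1/∣class∣ J₀ ℚ.*_) (∑-cong Js ∑-βx) ⟩
    1/∣class∣ J₀ ℚ.* ∑ Js (λ J → identityMatrix J ⊥)      ∎
    where
    open ≡-Reasoning
    Js = class R J₀

  ∑-e-⊥ : ∑ elements (e R ⊥) ≡ 1ℚ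
  ∑-e-⊥ = begin
    ∑ elements (e R ⊥)                                            ≡⟨ ∑-e ⊥ ⟩
    1/∣class∣ ⊥ ℚ.* ∑ (class R ⊥) (λ J → identityMatrix J ⊥)
      ≡⟨ cong₂ ℚ._*_ 1/∣class∣≡1 (cong (λ Js → ∑ Js λ J → identityMatrix J ⊥) class-⊥) ⟩
    1ℚ ℚ.* (identityMatrix (⊥ {n}) ⊥ ℚ.+ 0ℚ)
      ≡⟨ cong (λ q → 1ℚ ℚ.* (q ℚ.+ 0ℚ)) (if-true (dec-true (⊥ {n} ≟ˢ ⊥) refl)) ⟩
    1ℚ                                                            ∎
    where
    open ≡-Reasoning
    1/∣class∣≡1 : 1/∣class∣ ⊥ ≡ 1ℚ
    1/∣class∣≡1 = ℚ./-cong {ℤ.+ 1} {{class-nonZero R {⊥}}} refl (cong length class-⊥)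

  -- The class of `J₀` does not contain `⊥`, since only `⊥` is related to `⊥`; hence every term in
  -- `∑-e` is an off-diagonal entry of the identity matrix.
  ∑-e-≢⊥ : ∀ {J₀} → J₀ ≢ ⊥ → ∑ elements (e R J₀) ≡ 0ℚ
  ∑-e-≢⊥ {J₀} J₀≢⊥ = begin
    ∑ elements (e R J₀)                                           ≡⟨ ∑-e J₀ ⟩
    1/∣class∣ J₀ ℚ.* ∑ (class R J₀) (λ J → identityMatrix J ⊥)
      ≡⟨ cong (1/∣class∣ J₀ ℚ.*_) (ℚ-Sum.sum-zero (All.map vanishes (All.all-filter (_∼?_ R J₀) (subsets n)))) ⟩
    1/∣class∣ J₀ ℚ.* 0ℚ                                           ≡⟨ ℚ.*-zeroʳ (1/∣class∣ J₀) ⟩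
    0ℚ                                                            ∎
    where
    open ≡-Reasoning
    vanishes : ∀ {J} → _∼_ R J₀ J → identityMatrix J ⊥ ≡ 0ℚ
    vanishes {J} J₀∼J = if-false (dec-false (J ≟ˢ ⊥) λ { refl → J₀≢⊥ (∼⊥⇒≡⊥ J₀∼J) })

  -- Independence of the word representing a group element.

  Des-cong : ∀ {u w} → u ~ w → Des R u ≡ Des R w
  Des-cong u~w = Vec.tabulate-cong λ i → cong (does ∘ negative? R) (•-cong R u~w (simple i))

  x-cong : ∀ K {u w} → u ~ w → x R K u ≡ x R K w
  x-cong K u~w = cong indicator (Des-cong u~w)
    where
    -- The coefficient `x R K w` depends on `w` only through its descent set; this function makes
    -- the dependence explicit.
    indicator : Subset n → ℚ
    indicator D = if does ((D ∩ K) ≟ˢ ⊥) then 1ℚ else 0ℚ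

  e-cong : ∀ J₀ {u w} → u ~ w → e R J₀ u ≡ e R J₀ w
  e-cong J₀ u~w = cong (1/∣class∣ J₀ ℚ.*_)
    (∑-cong (class R J₀) λ J → ∑-cong (filter (_⊆? J) (subsets n)) λ K → cong (β R J K ℚ.*_) (x-cong K u~w))

-- The total mass of `M`.

open RealNumbers using (Carrier; _#_; 0#)

proposition1 : ∀ {c ℓ₁ ℓ₂ ℓ₃ : Level} (ℝ : RealNumbers c ℓ₁ ℓ₂ ℓ₃) {n : ℕ} (W : FiniteCoxeterGroup n)
    (R : ReflectionRepresentation ℝ W) (x : Carrier ℝ) (x≠0 : _#_ ℝ x (0# ℝ)) →
    IsSignedProbabilityMeasure ℝ W (M R x≠0)
proposition1 ℝ {n} W R x x≠0 = record { f-cong = M-cong ; total = total }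
  where
  open RealNumbers ℝ hiding (Carrier; _#_) renaming (0# to 0ᴿ)
  open FiniteCoxeterGroup W using (elements) renaming (_≈_ to _~_)
  open RealNumbersProperties ℝ
  open ListSumProperties commutativeRing
  open ListSum commutativeRing using () renaming (∑ to ∑ᴿ)
  open SetoidReasoning setoid

  x^-_ : ℕ → Carrier ℝ
  x^- k = (RealNumbers._⁻¹ ℝ x≠0) ^ k

  M-cong : ∀ {u w} → u ~ w → M R x≠0 u ≈ M R x≠0 w
  M-cong u~w = sum-cong (classes R) λ J → *-congʳ (reflexive (cong fromℚ (e-cong R J u~w)))

  -- The power of the inverse of `x` is constant in `w` and factors out; additivity of `fromℚ` then
  -- moves the sum over the group into ℚ, where the augmentation is known.
  ∑-e-x^- : ∀ J → ∑ᴿ elements (λ w → fromℚ (e R J w) * x^- ∣ J ∣) ≈ fromℚ (∑ elements (e R J)) * x^- ∣ J ∣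
  ∑-e-x^- J = ≈-trans (sum-*ʳ elements (λ w → fromℚ (e R J w)) (x^- ∣ J ∣))
    (*-congʳ (≈-sym (fromℚ-∑ elements (e R J))))

  vanishes : ∀ J → J ≢ ⊥ → fromℚ (∑ elements (e R J)) * x^- ∣ J ∣ ≈ 0ᴿ
  vanishes J J≢⊥ = ≈-trans (*-congʳ (≈-trans (reflexive (cong fromℚ (∑-e-≢⊥ R J≢⊥))) fromℚ-0)) (zeroˡ _)

  total : ∑ᴿ elements (M R x≠0) ≈ 1#
  total = begin
    ∑ᴿ elements (λ w → ∑ᴿ (classes R) λ J → fromℚ (e R J w) * x^- ∣ J ∣)
      ≈⟨ sum-swap elements (classes R) (λ w J → fromℚ (e R J w) * x^- ∣ J ∣) ⟩
    ∑ᴿ (classes R) (λ J → ∑ᴿ elements λ w → fromℚ (e R J w) * x^- ∣ J ∣)  ≈⟨ sum-cong (classes R) ∑-e-x^- ⟩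
    ∑ᴿ (classes R) (λ J → fromℚ (∑ elements (e R J)) * x^- ∣ J ∣)
      -- The list `classes` has no repetitions and contains `⊥` itself, because no other subset is
      -- related to `⊥` and could stand in for it.
      ≈⟨ sum-concentrated (deduplicate-! (_∼?_ R) (∼-refl R _) (subsets n))
        (∈-deduplicate⁺ (_∼?_ R) (∼⊥⇒≡⊥ R) (∈-subsets ⊥)) vanishes ⟩
    fromℚ (∑ elements (e R ⊥)) * x^- ∣ ⊥ {n} ∣
      -- With exponent `∣ ⊥ ∣ ≡ 0` the power reduces to `1#`, so the result no longer depends on
      -- `x`.
      ≡⟨ cong₂ (λ q k → fromℚ q * x^- k) (∑-e-⊥ R) (∣⊥∣≡0 n) ⟩
    fromℚ 1ℚ * 1#                                                         ≈⟨ *-identityʳ _ ⟩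
    fromℚ 1ℚ                                                              ≈⟨ fromℚ-1 ⟩
    1#                                                                    ∎
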